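{- Let $k\ge 2$ and $\ell\ge 0$ be constants. There is a deterministic $\mathsf{Online}$-$\mathsf{LOCAL}$ algorithm with locality $O(\log n)$ that properly colors every $n$-node connected graph in $\mathcal{L}_{k,\ell}$ using colors from $\{1,\dots,k+1\}$.
   Context: A graph is $k$-partite if it admits a proper coloring with $k$ colors. For a graph $G=(V,E)$, $U\subseteq V$ and an integer $T\ge 0$, $\mathcal{B}(U,T)$ denotes the set of nodes at distance at most $T$ from some node of $U$, and $G[U]$ denotes the induced subgraph. Locally inferable unique colorings: let $G$ be a $k$-partite graph and $\ell\ge0$ an integer. For a connected subgraph $G'=(V',E')$ of $G$, let $\mathcal{C}^*(G',\ell)$ be the set of all proper $k$-colorings (colors $\{1,\dots,k\}$) of $G[\mathcal{B}(V',\ell)]$, and $\mathcal{C}(G',\ell)$ the set of restrictions to $V'$ of colorings in $\mathcal{C}^*(G',\ell)$. Two $k$-colorings $c,c'$ are identical up to a permutation if $c'=\phi\circ c$ for some permutation $\phi$ of $\{1,\dots,k\}$. $\mathcal{L}_{k,\ell}$ is the class of $k$-partite graphs $G$ such that for every connected subgraph $G'$ of $G$, all colorings in $\mathcal{C}(G',\ell)$ are identical up to a permutation. The $\mathsf{Online}$-$\mathsf{LOCAL}$ model: an algorithm with locality $T=T(n)$ is deterministic and knows $n$. The adversary chooses an $n$-node input graph $G=(V,E)$ from the input family, assigns distinct identifiers from $\{1,\dots,\mathrm{poly}(n)\}$ to its nodes, and chooses an ordering $\sigma=(v_1,\dots,v_n)$ of $V$. For $i=1,\dots,n$, when $v_i$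 is presented, the algorithm must irrevocably assign an output (here a color) to $v_i$ as a function of the sequence $(v_1,\dots,v_i)$ and the induced subgraph $G_i=G\big[\bigcup_{j\le i}\mathcal{B}(v_j,T)\big]$ (with identifiers); thus the algorithm has global memory of everything seen so far. The algorithm solves a coloring problem on an input family if for every choice of the adversary the final coloring is proper and uses only the allowed colors. The locality of a problem is the minimum locality of an algorithm solving it. -}

module Defs where

open import Data.Bool using (Bool; T)
open import Data.Bool.Properties using (T?)
open import Data.Fin using (Fin; toℕ)
open import Data.Fin.Permutation using (Permutation′; _⟨$⟩ʳ_; _⟨$⟩ˡ_)
open import Data.Fin.Properties using (_≟_; any?)
open import Data.Fin.Subset using (Subset; _∈_)
open import Data.List using (List; take; tabulate; map)
open import Data.List.Membership.DecPropositional using (_∈?_)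
open import Data.List.Membership.Propositional using () renaming (_∈_ to _∈ˡ_)
open import Data.Nat using (ℕ; zero; suc; _*_; _^_; _≤_; _<_)
open import Data.Nat.Properties using (anyUpTo?)
open import Data.Product using (∃; ∃-syntax; _×_; _,_)
open import Data.Vec using (Vec) renaming (tabulate to tabulateᵛ)
open import Function.Definitions using (Injective)
open import Level using (0ℓ)
open import Relation.Binary.Core using (Rel)
open import Relation.Binary.Definitions using (Symmetric; Irreflexive)
open import Relation.Binary.PropositionalEquality using (_≡_; _≢_; refl)
open import Relation.Nullary using (Dec; yes; no; does)
open import Relation.Nullary.Decidable using (_×-dec_)
open import Relation.Unary using (Pred; Decidable)

infix 4 _=O_

_=O_ : (ℕ → ℕ) → (ℕ → ℕ) → Set
f =O g = ∃[ C ] ∃[ n₀ ] (∀ n → n₀ ≤ n → f n ≤ C * g n)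

PolynomiallyBounded : (ℕ → ℕ) → Set
PolynomiallyBounded f = ∃[ c ] f =O (λ n → n ^ c)

record Graph (n : ℕ) : Set where
  field
    adj : Fin n → Fin n → Bool

  _~_ : Rel (Fin n) 0ℓ
  u ~ v = T (adj u v)

  field
    ~-sym    : Symmetric _~_
    ~-irrefl : Irreflexive _≡_ _~_

data Walk {n : ℕ} (R : Rel (Fin n) 0ℓ) : Fin n → Fin n → ℕ → Set where
  nil  : ∀ {v} → Walk R v v zero
  cons : ∀ {u v w m} → R u v → Walk R v w m → Walk R u w (suc m)

module _ {n : ℕ} (G : Graph n) where
  open Graph G

  DistAtMost : ℕ → Fin n → Fin n → Set
  DistAtMost t u v = ∃[ m ] (m < suc t × Walk _~_ u v m)

  𝓑 : Pred (Fin n) 0ℓ → ℕ → Pred (Fin n) 0ℓ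
  𝓑 U t v = ∃[ u ] (U u × DistAtMost t u v)

  Connected : Set
  Connected = ∀ u v → ∃[ m ] Walk _~_ u v m

  Proper : ∀ {q} → (Fin n → Fin q) → Set
  Proper c = ∀ {u v} → u ~ v → c u ≢ c v

  -- Proper colorings of the induced subgraph G[U], represented by functions
  -- on all nodes whose values outside U are irrelevant.
  ProperOn : ∀ {q} → Pred (Fin n) 0ℓ → (Fin n → Fin q) → Set
  ProperOn U c = ∀ {u v} → U u → U v → u ~ v → c u ≢ c v

  Partite : ℕ → Set
  Partite k = ∃[ c ] Proper {k} c

  -- Not necessarily induced.
  record Subgraph : Set where
    field
      V′ : Subset n
      E′ : Fin n → Fin n → Bool

    _~′_ : Rel (Fin n) 0ℓ
    u ~′ v = T (E′ u v)

    field
      ~′-sym : Symmetric _~′_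
      ~′⇒~   : ∀ {u v} → u ~′ v → u ~ v
      ~′⇒∈   : ∀ {u v} → u ~′ v → u ∈ V′ × v ∈ V′

  ConnectedSubgraph : Subgraph → Set
  ConnectedSubgraph H = ∀ {u v} → u ∈ V′ → v ∈ V′ → ∃[ m ] Walk _~′_ u v m
    where open Subgraph H

  module _ (k ℓ : ℕ) (H : Subgraph) where
    open Subgraph H

    𝓒* : Pred (Fin n → Fin k) 0ℓ
    𝓒* = ProperOn (𝓑 (_∈ V′) ℓ)

    -- Colorings of V′, again with irrelevant values elsewhere.
    𝓒 : Pred (Fin n → Fin k) 0ℓ
    𝓒 c = ∃[ c* ] (𝓒* c* × (∀ {v} → v ∈ V′ → c v ≡ c* v))

    IdenticalUpToPermutation : (c c′ : Fin n → Fin k) → Set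
    IdenticalUpToPermutation c c′ =
      ∃ λ (φ : Permutation′ k) → ∀ {v} → v ∈ V′ → c′ v ≡ φ ⟨$⟩ʳ c v

𝓛 : ℕ → ℕ → ∀ {n} → Graph n → Set
𝓛 k ℓ G = Partite G k ×
  (∀ (H : Subgraph G) → ConnectedSubgraph G H →
   ∀ c c′ → 𝓒 G k ℓ H c → 𝓒 G k ℓ H c′ → IdenticalUpToPermutation G k ℓ H c c′)

module _ {n : ℕ} (G : Graph n) where
  open Graph G

  walk? : ∀ u v m → Dec (Walk _~_ u v m)
  walk? u v zero with u ≟ v
  ... | yes refl = yes nil
  ... | no  u≢v  = no λ { nil → u≢v refl }
  walk? u v (suc m) with any? (λ w → T? (adj u w) ×-dec walk? w v m)
  ... | yes (_ , e , p) = yes (cons e p)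
  ... | no  ¬p          = no λ { (cons e p) → ¬p (_ , e , p) }

  𝓑? : ∀ {U} → Decidable U → ∀ t → Decidable (𝓑 G U t)
  𝓑? U? t v = any? λ u → U? u ×-dec anyUpTo? (walk? u v) (suc t)

-- What an algorithm has seen so far, expressed purely in terms of identifiers.
-- Element a of Fin N stands for the identifier a + 1 of {1,…,N}.
record View (N : ℕ) : Set where
  constructor mkView
  field
    presented : List (Fin N)          -- v₁,…,vᵢ in order, the current node last
    nodes     : Subset N
    edges     : Vec (Vec Bool N) N

module _ {n N : ℕ} (G : Graph n) (ident : Fin n → Fin N) (σ : Permutation′ n) (t : ℕ) where
  open Graph G

  -- Rounds are numbered from 0; σ ⟨$⟩ʳ i is the node presented in round i.
  presentedUpTo : Fin n → List (Fin n)
  presentedUpTo i = take (suc (toℕ i)) (tabulate (σ ⟨$⟩ʳ_))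

  Seen : Fin n → Pred (Fin n) 0ℓ
  Seen i = 𝓑 G (_∈ˡ presentedUpTo i) t

  seen? : ∀ i → Decidable (Seen i)
  seen? i = 𝓑? G (λ u → _∈?_ _≟_ u (presentedUpTo i)) t

  node? : ∀ i a → Dec (∃[ u ] (ident u ≡ a × Seen i u))
  node? i a = any? λ u → (ident u ≟ a) ×-dec seen? i u

  edge? : ∀ i a b →
    Dec (∃[ u ] ∃[ v ] ((ident u ≡ a × Seen i u) × (ident v ≡ b × Seen i v) × u ~ v))
  edge? i a b = any? λ u → any? λ v →
    ((ident u ≟ a) ×-dec seen? i u) ×-dec ((ident v ≟ b) ×-dec seen? i v) ×-dec T? (adj u v)

  view : Fin n → View N
  view i = mkView
    (map ident (presentedUpTo i))
    (tabulateᵛ λ a → does (node? i a))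
    (tabulateᵛ λ a → tabulateᵛ λ b → does (edge? i a b))

-- idBound n is the size of the identifier space for n-node graphs; q is the
-- number of colors.
record OnlineLocal (idBound : ℕ → ℕ) (q : ℕ) : Set where
  field
    locality : ℕ → ℕ
    output   : ∀ n → View (idBound n) → Fin q

  coloring : ∀ {n} → Graph n → (Fin n → Fin (idBound n)) → Permutation′ n → Fin n → Fin q
  coloring {n} G ident σ v = output n (view G ident σ (locality n) (σ ⟨$⟩ˡ v))

  SolvesColoringOn : (∀ {n} → Graph n → Set) → Set
  SolvesColoringOn 𝓕 = ∀ {n} (G : Graph n) → 𝓕 G →
    ∀ (ident : Fin n → Fin (idBound n)) → Injective _≡_ _≡_ ident →
    ∀ (σ : Permutation′ n) → Proper G (coloring G ident σ)

{-# OPTIONS --safe #-}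
module Submission where

-- Let c be a fixed proper k-coloring of G, unknown to the algorithm.  The nodes
-- within distance ρ of the presented ones split into connected groups, and by
-- local uniqueness every k-coloring found on the explored region agrees with c
-- on a group up to a permutation.  The algorithm keeps alive a (k+1)-coloring f
-- extending its outputs such that, on each group with s presented nodes, f is c
-- followed by an injective palette, except within distance A ⌊log₂ s⌋ of the
-- presented nodes.  When groups merge, the largest one imposes its palette; each
-- other group reaches it in A layers around its exceptional ball, changing one
-- color class per layer by means of the spare color.  The size of such a group
-- at least doubles, which pays for the A extra layers, so ρ = O(log n) suffices.
-- As the invariant is decidable, the algorithm just searches for an output that
-- preserves it.

open import Data.Bool using (Bool; T)
open import Data.Bool.Properties using (T?)
open import Data.Empty using (⊥)
open import Data.Fin using (Fin; zero; suc; toℕ; inject₁)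
open import Data.Fin.Permutation using (Permutation′; _⟨$⟩ʳ_; _⟨$⟩ˡ_; inverseˡ; inverseʳ)
open import Data.Fin.Properties
  using (_≟_; any?; all?; injective⇒≤; toℕ-injective; toℕ<n; inject₁-injective)
import Data.Fin.Subset as Subset
open import Data.List
  using (List; []; _∷_; _++_; [_]; length; filter; allFin; reverse; map; take; drop; tabulate)
open import Data.List.Extrema.Nat using (argmax; argmax-all; f[xs]≤f[argmax])
open import Data.List.Membership.DecPropositional using (_∈?_)
open import Data.List.Membership.Propositional using (_∈_)
open import Data.List.Membership.Propositional.Properties
  using (∈-filter⁺; ∈-allFin; ∈-map⁺; ∈-map⁻; ∈-tabulate⁺)
open import Data.List.Properties
  using (length-filter; length-reverse; length-map; length-tabulate; take-suc-tabulate;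
         take++drop≡id; map-++; reverse-++)
open import Data.List.Relation.Binary.Subset.Propositional using (_⊆_)
open import Data.List.Relation.Unary.All as All using (All; []; _∷_)
open import Data.List.Relation.Unary.All.Properties using (all-filter)
open import Data.List.Relation.Unary.Any using (here; there)
import Data.List.Relation.Unary.Any.Properties as Any
open import Data.Nat
  using (ℕ; zero; suc; _+_; _*_; _∸_; _≤_; _<_; _≤?_; z≤n; s≤s; z<s; s<s; s≤s⁻¹; s<s⁻¹; >-nonZero)
  renaming (_≟_ to _≟ℕ_)
open import Data.Nat.Logarithm using (⌊log₂_⌋; ⌊log₂⌋-mono-≤; ⌊log₂[2*b]⌋≡1+⌊log₂b⌋)
open import Data.Nat.Properties hiding (_≟_)
open import Data.Product
  using (Σ; Σ-syntax; ∃; ∃-syntax; _×_; _,_; proj₁; proj₂; map₂)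
open import Data.Sum using (_⊎_; inj₁; inj₂)
open import Data.Unit using (⊤)
open import Data.Vec using (Vec; lookup) renaming (tabulate to tabulateᵛ)
open import Data.Vec.Functional using (updateAt) renaming (_∷_ to _∷ᶠ_)
open import Data.Vec.Functional.Properties using (updateAt-updates; updateAt-minimal)
open import Data.Vec.Properties using (tabulate-cong; lookup⇒[]=; []=⇒lookup)
  renaming (lookup∘tabulate to lookup∘tabulateᵛ)
open import Function using (_∘_; const; id; mk⇔)
open import Function.Definitions using (Injective)
open import Level using (0ℓ)
open import Relation.Binary.Construct.Closure.ReflexiveTransitive as Star
  using (Star; ε; _◅_; _◅◅_; return)
open import Relation.Binary.Core using (Rel; _⇒_)
import Relation.Binary.Definitions as B
open import Relation.Binary.PropositionalEquality hiding ([_])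
open import Relation.Nullary using (Dec; yes; no; does; ¬_; contradiction)
open import Relation.Nullary.Decidable
  using (map′; _×-dec_; _⊎-dec_; _→-dec_; ¬?; does-⇔; dec-true)
open import Relation.Unary using (Pred; Decidable) renaming (_⊆_ to _⊑_)
open import Defs

private variable
  n N k q : ℕ

-- Finite search

abstract
  -- Functions are enumerated by first value and tail. The function rebuilt from these is only
  -- pointwise equal to the original, which is why `P` must respect `≗`.
  anyFunction? : {P : Pred (Fin n → Fin q) 0ℓ} → (∀ {f g} → f ≗ g → P f → P g) →
    Decidable P → Dec (∃ P)
  anyFunction? {zero} resp P? = map′ (_ ,_) (λ (_ , p) → resp (λ ()) p) (P? λ ())
  anyFunction? {suc n} {P = P} resp P? =
    map′ (λ (a , f , p) → a ∷ᶠ f , p)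
         (λ (f , p) → f zero , f ∘ suc , resp (λ { zero → refl ; (suc _) → refl }) p)
         (any? λ a → anyFunction? {P = λ f → P (a ∷ᶠ f)}
            (λ f≗g → resp λ { zero → refl ; (suc i) → f≗g i }) λ f → P? (a ∷ᶠ f))

abstract
  -- Serves twice: with `toℕ` as `h` it selects a representative of a group, with the group size it
  -- selects the group whose palette survives a merge.
  ∃-maximal : {Q : Pred (Fin n) 0ℓ} → Decidable Q → (h : Fin n → ℕ) → ∃ Q →
    ∃[ w ] (Q w × (∀ u → Q u → h u ≤ h w))
  ∃-maximal {n = n} Q? h (w₀ , q₀) =
    argmax h w₀ candidates ,
    argmax-all h q₀ (all-filter Q? (allFin n)) ,
    λ u q → All.lookup (f[xs]≤f[argmax] w₀ candidates) (∈-filter⁺ Q? (∈-allFin u) q)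
    where
    candidates : List (Fin n)
    candidates = filter Q? (allFin n)

abstract
  -- A search below a bound; the bound itself is the value when nothing smaller qualifies.
  least : {Q : Pred ℕ 0ℓ} → Decidable Q → ℕ → ℕ
  least Q? zero    = zero
  least Q? (suc m) with Q? zero
  ... | yes _ = zero
  ... | no _  = suc (least (λ t → Q? (suc t)) m)

  least-≤ : {Q : Pred ℕ 0ℓ} (Q? : Decidable Q) (m : ℕ) {t : ℕ} → Q t → least Q? m ≤ t
  least-≤ Q? zero q = z≤n
  least-≤ Q? (suc m) {t} q with Q? zero
  ... | yes _ = z≤n
  least-≤ Q? (suc m) {zero}  q | no ¬q = contradiction q ¬q
  least-≤ Q? (suc m) {suc t} q | no _  = s≤s (least-≤ (λ t → Q? (suc t)) m q)

  least-≤-bound : {Q : Pred ℕ 0ℓ} (Q? : Decidable Q) (m : ℕ) → least Q? m ≤ m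
  least-≤-bound Q? zero = z≤n
  least-≤-bound Q? (suc m) with Q? zero
  ... | yes _ = z≤n
  ... | no _  = s≤s (least-≤-bound (λ t → Q? (suc t)) m)

  least-holds : {Q : Pred ℕ 0ℓ} (Q? : Decidable Q) (m : ℕ) → least Q? m < m → Q (least Q? m)
  least-holds Q? (suc m) lt with Q? zero
  ... | yes q = q
  ... | no _  = least-holds (λ t → Q? (suc t)) m (s<s⁻¹ lt)

-- Decidability of reachability

module _ {R : Rel (Fin n) 0ℓ} (R? : B.Decidable R) where

  -- Warshall: Through m relates u to v when u reaches v via intermediate nodes below m.
  private
    Through : ℕ → Rel (Fin n) 0ℓ
    Through zero    u v = u ≡ v ⊎ R u v
    Through (suc m) u v = Through m u v ⊎ ∃[ w ] (toℕ w ≡ m × Through m u w × Through m w v)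

    through? : ∀ m → B.Decidable (Through m)
    through? zero    u v = (u ≟ v) ⊎-dec R? u v
    through? (suc m) u v = through? m u v ⊎-dec
      any? λ w → (toℕ w ≟ℕ m) ×-dec through? m u w ×-dec through? m w v

    sound : ∀ m {u v} → Through m u v → Star R u v
    sound zero    (inj₁ refl) = ε
    sound zero    (inj₂ r)    = return r
    sound (suc m) (inj₁ p)    = sound m p
    sound (suc m) (inj₂ (_ , _ , p , q)) = sound m p ◅◅ sound m q

    through-trans : ∀ m {u w v} → toℕ w < m → Through m u w → Through m w v → Through m u v
    through-trans (suc m) {w = w} w<1+m p q with m<1+n⇒m<n∨m≡n w<1+m
    through-trans (suc m) {u} {w} {v} _ p q | inj₂ refl =
      inj₂ (w , refl , to p , from q)
      where
      to : Through (suc m) u w → Through m u w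
      to (inj₁ p) = p
      to (inj₂ (x , x≡m , p , _)) = subst (Through m u) (toℕ-injective x≡m) p
      from : Through (suc m) w v → Through m w v
      from (inj₁ q) = q
      from (inj₂ (x , x≡m , _ , q)) = subst (λ x → Through m x v) (toℕ-injective x≡m) q
    through-trans (suc m) _ (inj₁ p) (inj₁ q) | inj₁ w<m = inj₁ (through-trans m w<m p q)
    through-trans (suc m) _ (inj₁ p) (inj₂ (x , e , q , q′)) | inj₁ w<m =
      inj₂ (x , e , through-trans m w<m p q , q′)
    through-trans (suc m) _ (inj₂ (x , e , p , p′)) (inj₁ q) | inj₁ w<m =
      inj₂ (x , e , p , through-trans m w<m p′ q)
    through-trans (suc m) _ (inj₂ (x , e , p , _)) (inj₂ (y , e′ , _ , q)) | inj₁ w<m =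
      inj₂ (x , e , p , subst (λ y → Through m y _) (toℕ-injective (trans e′ (sym e))) q)

    edge : ∀ m {u v} → R u v → Through m u v
    edge zero    r = inj₂ r
    edge (suc m) r = inj₁ (edge m r)

    loop : ∀ m {u} → Through m u u
    loop zero    = inj₁ refl
    loop (suc m) = inj₁ (loop m)

    complete : ∀ {u v} → Star R u v → Through n u v
    complete ε = loop n
    complete (r ◅ rs) = through-trans n (toℕ<n _) (edge n r) (complete rs)

  abstract
    star? : B.Decidable (Star R)
    star? u v = map′ (sound n) complete (through? n u v)

-- Counting in lists

module _ {A : Set} where

  count : {Q : Pred A 0ℓ} → Decidable Q → List A → ℕ
  count Q? xs = length (filter Q? xs)

  count-mono : {Q Q′ : Pred A 0ℓ} (Q? : Decidable Q) (Q′? : Decidable Q′) (xs : List A) →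
    (∀ {x} → Q x → Q′ x) → count Q? xs ≤ count Q′? xs
  count-mono Q? Q′? [] sub = z≤n
  count-mono Q? Q′? (x ∷ xs) sub with ih ← count-mono Q? Q′? xs sub | Q? x | Q′? x
  ... | yes q | yes _  = s≤s ih
  ... | yes q | no ¬q′ = contradiction (sub q) ¬q′
  ... | no _  | yes _  = m≤n⇒m≤1+n ih
  ... | no _  | no _   = ih

  count-tail-≤ : {Q : Pred A 0ℓ} (Q? : Decidable Q) (x : A) (xs : List A) →
    count Q? xs ≤ count Q? (x ∷ xs)
  count-tail-≤ Q? x xs with Q? x
  ... | yes _ = n≤1+n _
  ... | no _  = ≤-refl

  -- Gives the doubling of the size when two old groups end up in one new group.
  count-disjoint : {Q₁ Q₂ Q : Pred A 0ℓ} (Q₁? : Decidable Q₁) (Q₂? : Decidable Q₂) (Q? : Decidable Q)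
    (xs : List A) → (∀ {x} → Q₁ x → Q x) → (∀ {x} → Q₂ x → Q x) → (∀ {x} → Q₁ x → ¬ Q₂ x) →
    count Q₁? xs + count Q₂? xs ≤ count Q? xs
  count-disjoint Q₁? Q₂? Q? [] _ _ _ = z≤n
  count-disjoint Q₁? Q₂? Q? (x ∷ xs) sub₁ sub₂ dis
    with ih ← count-disjoint Q₁? Q₂? Q? xs sub₁ sub₂ dis | Q₁? x | Q₂? x | Q? x
  ... | yes q₁ | yes q₂ | _     = contradiction q₂ (dis q₁)
  ... | yes q₁ | no _   | no ¬q = contradiction (sub₁ q₁) ¬q
  ... | no _   | yes q₂ | no ¬q = contradiction (sub₂ q₂) ¬q
  ... | yes _  | no _   | yes _ = s≤s ih
  ... | no _   | yes _  | yes _ = ≤-trans (≤-reflexive (+-suc _ _)) (s≤s ih)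
  ... | no _   | no _   | yes _ = m≤n⇒m≤1+n ih
  ... | no _   | no _   | no _  = ih

  count-positive : {Q : Pred A 0ℓ} (Q? : Decidable Q) {x : A} {xs : List A} →
    x ∈ xs → Q x → 0 < count Q? xs
  count-positive Q? {xs = y ∷ _} (here refl) q with Q? y
  ... | yes _ = z<s
  ... | no ¬q = contradiction q ¬q
  count-positive Q? {xs = y ∷ _} (there x∈xs) q with Q? y
  ... | yes _ = z<s
  ... | no _  = count-positive Q? x∈xs q

-- Recoloring

-- Adjacent nodes may be colored one through π and the other through π′; in
-- particular Compatible π π is injectivity.
Compatible : (π π′ : Fin k → Fin q) → Set
Compatible π π′ = ∀ {a b} → a ≢ b → π a ≢ π′ b

-- A sequence of palettes to be laid out in consecutive distance layers: edges inside a layer need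
-- injectivity, edges between neighboring layers need compatibility. Injectivity of the last palette
-- is supplied separately.
data Transition {k q : ℕ} : ℕ → (π π′ : Fin k → Fin q) → Set where
  done : ∀ {π} → Transition 0 π π
  _∷_  : ∀ {π ρ π′ m} → Compatible π π × Compatible π ρ → Transition m ρ π′ → Transition (suc m) π π′

stage : ∀ {m} {π π′ : Fin k → Fin q} → Transition m π π′ → ℕ → Fin k → Fin q
stage {π = π} _        zero    = π
stage {π = π} done     (suc _) = π
stage         (_ ∷ ts) (suc i) = stage ts i

stage-injective : ∀ {m} {π π′ : Fin k → Fin q} (ts : Transition m π π′) → Compatible π′ π′ →
  ∀ i → Compatible (stage ts i) (stage ts i)
stage-injective done             inj zero    = inj
stage-injective done             inj (suc i) = inj
stage-injective ((inj , _) ∷ ts) _   zero    = inj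
stage-injective (_ ∷ ts)         inj (suc i) = stage-injective ts inj i

stage-compatible : ∀ {m} {π π′ : Fin k → Fin q} (ts : Transition m π π′) → Compatible π′ π′ →
  ∀ i → Compatible (stage ts i) (stage ts (suc i))
stage-compatible done              inj zero    = inj
stage-compatible done              inj (suc i) = inj
stage-compatible ((_ , comp) ∷ ts) inj zero    = comp
stage-compatible (_ ∷ ts)          inj (suc i) = stage-compatible ts inj i

stage-final : ∀ {m} {π π′ : Fin k → Fin q} (ts : Transition m π π′) {i} → m ≤ i → stage ts i ≡ π′
stage-final done {zero}  _ = refl
stage-final done {suc i} _ = refl
stage-final (_ ∷ ts) (s≤s m≤i) = stage-final ts m≤i

-- Pigeonhole: if every color were used, choosing preimages would inject `Fin (suc k)` into `Fin k`.
free-color : (π : Fin k → Fin (suc k)) → ∃[ h ] (∀ a → π a ≢ h)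
free-color {k} π with any? (λ h → all? (λ a → ¬? (π a ≟ h)))
... | yes free = free
... | no ¬free = contradiction (injective⇒≤ {f = λ h → proj₁ (preimage h)} inj) (n≮n k)
  where
  preimage : ∀ h → ∃[ a ] π a ≡ h
  preimage h with any? (λ a → π a ≟ h)
  ... | yes p = p
  ... | no ¬p = contradiction (h , λ a e → ¬p (a , e)) ¬free
  inj : Injective _≡_ _≡_ (λ h → proj₁ (preimage h))
  inj {h} {h′} e = trans (sym (proj₂ (preimage h))) (trans (cong π e) (proj₂ (preimage h′)))

module Recoloring {k : ℕ} (π* : Fin k → Fin (suc k)) (π*-inj : Compatible π* π*) where

  -- The field `preserved` lets the color classes be corrected one after another without undoing
  -- earlier corrections.
  record Step (m : ℕ) (π : Fin k → Fin (suc k)) (Done : Pred (Fin k → Fin (suc k)) 0ℓ) : Set where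
    constructor mkStep
    field
      {next}     : Fin k → Fin (suc k)
      transition : Transition m π next
      injective  : Compatible next next
      goal       : Done next
      preserved  : ∀ a → π a ≡ π* a → next a ≡ π* a

  private variable
    π : Fin k → Fin (suc k)

  stay : Compatible π π → ∀ {Done} → Done π → Step 1 π Done
  stay inj d = mkStep ((inj , inj) ∷ done) inj d (λ _ → id)

  set : Compatible π π → ∀ b h → (∀ a → π a ≢ h) → π b ≢ π* b →
    ∀ {Done} → Done (updateAt π b (const h)) → Step 1 π Done
  set {π} inj b h free wrong d = mkStep ((inj , step) ∷ done) inj′ d pres
    where
    π′ = updateAt π b (const h)
    step : Compatible π π′
    step {a} {a′} a≢a′ e with a′ ≟ b
    ... | yes refl = free a (trans e (updateAt-updates b π))
    ... | no a′≢b  = inj a≢a′ (trans e (updateAt-minimal a′ b π a′≢b))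
    inj′ : Compatible π′ π′
    inj′ {a} {a′} a≢a′ e with a ≟ b
    ... | no a≢b   = step a≢a′ (trans (sym (updateAt-minimal a b π a≢b)) e)
    ... | yes refl = step (a≢a′ ∘ sym) (trans (sym (updateAt-minimal a′ b π (a≢a′ ∘ sym))) (sym e))
    pres : ∀ a → π a ≡ π* a → π′ a ≡ π* a
    pres a ok with a ≟ b
    ... | yes refl = contradiction ok wrong
    ... | no a≢b   = trans (updateAt-minimal a b π a≢b) ok

  -- The target color of x is vacated first, by moving its current owner to the free color.
  vacate : Compatible π π → ∀ x → π x ≢ π* x → Step 1 π (λ π′ → ∀ a → π′ a ≢ π* x)
  vacate {π} inj x wrong with any? (λ b → π b ≟ π* x)
  ... | no free = stay inj λ a e → free (a , e)
  ... | yes (b , πb≡) = let h , free = free-color π in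
    set inj b h free (λ ok → π*-inj x≢b (trans (sym πb≡) ok)) (vacated h free)
    where
    x≢b : x ≢ b
    x≢b refl = wrong πb≡
    vacated : ∀ h → (∀ a → π a ≢ h) → ∀ a → updateAt π b (const h) a ≢ π* x
    vacated h free a e with a ≟ b
    ... | yes refl = free b (trans πb≡ (trans (sym e) (updateAt-updates b π)))
    ... | no a≢b   = inj a≢b (trans (trans (sym (updateAt-minimal a b π a≢b)) e) (sym πb≡))

  -- One layer vacates the target color and one moves `x` into it. Idle layers pad the other case,
  -- so that the length does not depend on the palettes.
  fix : Compatible π π → ∀ x → Step 2 π (λ π′ → π′ x ≡ π* x)
  fix {π} inj x with π x ≟ π* x
  ... | yes ok = mkStep ((inj , inj) ∷ (inj , inj) ∷ done) inj ok (λ _ → id)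
  ... | no wrong with vacate inj x wrong
  ... | mkStep {π₁} (c ∷ done) injᵥ free pres with set injᵥ x (π* x) free (free x)
                                    {λ π′ → π′ x ≡ π* x} (updateAt-updates x π₁)
  ...   | mkStep (c′ ∷ done) injₛ ok pres′ =
    mkStep (c ∷ c′ ∷ done) injₛ ok (λ a → pres′ a ∘ pres a)

  -- The alternative `π a ≡ π* a` strengthens the induction: a class corrected at the head counts as
  -- already correct for the tail.
  fixAll : Compatible π π → ∀ xs →
    ∃[ π′ ] (Transition (length xs * 2) π π′ × Compatible π′ π′ ×
             (∀ a → a ∈ xs ⊎ π a ≡ π* a → π′ a ≡ π* a))
  fixAll {π} inj [] = π , done , inj , λ { a (inj₂ ok) → ok }
  fixAll inj (x ∷ xs) with fix inj x
  ... | mkStep (c ∷ c′ ∷ done) injₓ ok pres with fixAll injₓ xs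
  ...   | π′ , ts , inj′ , final = π′ , c ∷ c′ ∷ ts , inj′ , λ where
    a (inj₁ (here refl))  → final a (inj₂ ok)
    a (inj₁ (there a∈xs)) → final a (inj₁ a∈xs)
    a (inj₂ ok′)          → final a (inj₂ (pres a ok′))

recoloringTime : ℕ → ℕ
recoloringTime k = length (allFin k) * 2

abstract
  recoloring : (π π* : Fin k → Fin (suc k)) → Compatible π π → Compatible π* π* →
    ∃[ π′ ] (Transition (recoloringTime k) π π′ × Compatible π′ π′ × π′ ≗ π*)
  recoloring {k} π π* inj inj* with Recoloring.fixAll π* inj* inj (allFin k)
  ... | π′ , ts , inj′ , final = π′ , ts , inj′ , λ a → final a (inj₁ (∈-allFin a))

-- Groups of explored nodes

module Ball {N : ℕ} (E : Rel (Fin N) 0ℓ) (P : List (Fin N)) where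

  data Near : ℕ → Pred (Fin N) 0ℓ where
    base : ∀ {t w} → w ∈ P → Near t w
    step : ∀ {t u w} → Near t u → E u w → Near (suc t) w

  near-mono : ∀ {s t w} → s ≤ t → Near s w → Near t w
  near-mono _         (base w∈P) = base w∈P
  near-mono (s≤s s≤t) (step n e) = step (near-mono s≤t n) e

  abstract
    near? : B.Decidable E → ∀ t → Decidable (Near t)
    near? E? t w with _∈?_ _≟_ w P
    near? E? t       w | yes w∈P = yes (base w∈P)
    near? E? zero    w | no w∉P  = no λ { (base w∈P) → w∉P w∈P }
    near? E? (suc t) w | no w∉P  = map′ (λ (_ , n , e) → step n e)
      (λ { (base w∈P) → contradiction w∈P w∉P ; (step n e) → _ , n , e })
      (any? λ u → near? E? t u ×-dec E? u w)

module Groups {N : ℕ} {E : Rel (Fin N) 0ℓ} (E? : B.Decidable E) (k ρ : ℕ) (P : List (Fin N)) where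

  open Ball E P public

  Link : Rel (Fin N) 0ℓ
  Link u w = Near ρ u × Near ρ w × E u w

  infix 4 _⇝_ _⇝?_

  -- Its classes are the groups; a node farther than `ρ` from `P` forms a class alone.
  _⇝_ : Rel (Fin N) 0ℓ
  _⇝_ = Star Link

  _⇝?_ : B.Decidable _⇝_
  _⇝?_ = star? λ u w → near? E? ρ u ×-dec near? E? ρ w ×-dec E? u w

  size : Fin N → ℕ
  size w = count (_⇝? w) P

  radius : Fin N → ℕ
  radius w = recoloringTime k * ⌊log₂ size w ⌋

  -- Distance to all of `P` may be used here: as long as the radius is at most `ρ`, any presented
  -- node within that distance of `u` belongs to the group of `u`.
  Outer : Pred (Fin N) 0ℓ
  Outer u = ¬ Near (radius u) u

  PaletteAt : (c : Fin N → Fin k) (f : Fin N → Fin (suc k)) → Fin N → Pred (Fin k → Fin (suc k)) 0ℓ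
  PaletteAt c f w π = Compatible π π × (∀ u → u ⇝ w → Outer u → f u ≡ π (c u))

  Valid : (c : Fin N → Fin k) → Pred (Fin N → Fin (suc k)) 0ℓ
  Valid c f = (∀ u w → Near ρ u → Near ρ w → E u w → f u ≢ f w) ×
              (∀ w → Near ρ w → ∃ (PaletteAt c f w))

  paletteAt-cong : ∀ {c c′ f f′ w π π′} → c ≗ c′ → f ≗ f′ → π ≗ π′ →
    PaletteAt c f w π → PaletteAt c′ f′ w π′
  paletteAt-cong {π = π} cc ff ππ (inj , out) =
    (λ a≢b e → inj a≢b (trans (ππ _) (trans e (sym (ππ _))))) ,
    λ u l o → trans (sym (ff u)) (trans (out u l o) (trans (cong π (cc u)) (ππ _)))

  valid-cong : ∀ {c c′ f f′} → c ≗ c′ → f ≗ f′ → Valid c f → Valid c′ f′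
  valid-cong cc ff (proper , pal) =
    (λ u w nu nw e eq → proper u w nu nw e (trans (ff u) (trans eq (sym (ff w))))) ,
    λ w nw → map₂ (paletteAt-cong cc ff λ _ → refl) (pal w nw)

  compatible? : B.Decidable (Compatible {k} {suc k})
  compatible? π π′ = map′ (λ p {a} {b} → p a b) (λ p a b → p)
    (all? λ a → all? λ b → ¬? (a ≟ b) →-dec ¬? (π a ≟ π′ b))

  valid? : ∀ c → Decidable (Valid c)
  valid? c f =
    (all? λ u → all? λ w → near? E? ρ u →-dec (near? E? ρ w →-dec (E? u w →-dec ¬? (f u ≟ f w)))) ×-dec
    (all? λ w → near? E? ρ w →-dec
      anyFunction? (paletteAt-cong (λ _ → refl) (λ _ → refl)) λ π →
        compatible? π π ×-dec
        all? λ u → (u ⇝? w) →-dec (¬? (near? E? (radius u) u) →-dec (f u ≟ π (c u))))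

  -- A walk witnessing `Near` never leaves distance `ρ`, so its edges are links. Hence every group
  -- contains a presented node and has positive size.
  near⇒linked : ∀ {t w} → t ≤ ρ → Near t w → ∃[ p ] (p ∈ P × p ⇝ w)
  near⇒linked _ (base w∈P) = _ , w∈P , ε
  near⇒linked t<ρ (step n e) with near⇒linked (<⇒≤ t<ρ) n
  ... | p , p∈P , l =
    p , p∈P , l ◅◅ return (near-mono (<⇒≤ t<ρ) n , near-mono t<ρ (step n e) , e)

  ⇝-near : ∀ {u w} → u ⇝ w → Near ρ w → Near ρ u
  ⇝-near ε             n = n
  ⇝-near ((n , _) ◅ _) _ = n

  radius-mono : ∀ {u w} → size u ≤ size w → radius u ≤ radius w
  radius-mono s = *-monoʳ-≤ (recoloringTime k) (⌊log₂⌋-mono-≤ s)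

  size-≤ : ∀ w → size w ≤ length P
  size-≤ w = length-filter (_⇝? w) P

  module _ (E-sym : B.Symmetric E) where

    ⇝-sym : ∀ {u w} → u ⇝ w → w ⇝ u
    ⇝-sym = Star.reverse λ (nu , nw , e) → nw , nu , E-sym e

    ⇝-radius : ∀ {u w} → u ⇝ w → radius u ≡ radius w
    ⇝-radius {u} {w} l = ≤-antisym
      (radius-mono (count-mono (_⇝? u) (_⇝? w) P (_◅◅ l)))
      (radius-mono (count-mono (_⇝? w) (_⇝? u) P (_◅◅ ⇝-sym l)))

    canonical : Fin N → Fin N
    canonical w = proj₁ (∃-maximal (_⇝? w) toℕ (w , ε))

    canonical-⇝ : ∀ w → canonical w ⇝ w
    canonical-⇝ w = proj₁ (proj₂ (∃-maximal (_⇝? w) toℕ (w , ε)))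

    canonical-cong : ∀ {u w} → u ⇝ w → canonical u ≡ canonical w
    canonical-cong {u} {w} l = toℕ-injective (≤-antisym (below l) (below (⇝-sym l)))
      where
      below : ∀ {u w} → u ⇝ w → toℕ (canonical u) ≤ toℕ (canonical w)
      below {u} {w} l = proj₂ (proj₂ (∃-maximal (_⇝? w) toℕ (w , ε))) _ (canonical-⇝ u ◅◅ l)

-- Merging groups

-- `room` leaves space for a complete transition around every exceptional ball. The inequality is
-- strict so that nodes at distance exactly `ρ`, which may be adjacent to unexplored ones, have
-- already reached the final palette.
module Extension {N k ρ : ℕ} {E : Rel (Fin N) 0ℓ} (E? : B.Decidable E) (E-sym : B.Symmetric E)
  {c : Fin N → Fin k} (c-proper : ∀ {u w} → E u w → c u ≢ c w)
  (v : Fin N) (P : List (Fin N)) (room : ∀ m → m ≤ suc (length P) →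
    recoloringTime k * ⌊log₂ m ⌋ + recoloringTime k < ρ)
  {f : Fin N → Fin (suc k)} (valid : Groups.Valid E? k ρ P c f) where

  private
    module Old = Groups E? k ρ P
    module New = Groups E? k ρ (v ∷ P)
    open Old using (_⇝_; _⇝?_)

    A : ℕ
    A = recoloringTime k

    ⇝-sym : ∀ {u w} → u ⇝ w → w ⇝ u
    ⇝-sym = Old.⇝-sym E-sym

    near-weaken : ∀ {t w} → Old.Near t w → New.Near t w
    near-weaken (Old.base w∈P) = New.base (there w∈P)
    near-weaken (Old.step n e) = New.step (near-weaken n) e

    ⇝-weaken : ∀ {u w} → u ⇝ w → u New.⇝ w
    ⇝-weaken = Star.map
      λ (nu , nw , e) → near-weaken nu , near-weaken nw , e

    -- Presenting `v` affects the group of `v` alone: a walk starting at `v` stays in that group,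
    -- and a walk starting in `P` existed before.
    joined-or-near : ∀ {t w} → t ≤ ρ → New.Near t w → (v New.⇝ w) ⊎ Old.Near t w
    joined-or-near _ (New.base (here refl)) = inj₁ ε
    joined-or-near _ (New.base (there w∈P)) = inj₂ (Old.base w∈P)
    joined-or-near t<ρ (New.step n e) with joined-or-near (<⇒≤ t<ρ) n
    ... | inj₁ l = inj₁ (l ◅◅ return (New.near-mono (<⇒≤ t<ρ) n , New.near-mono t<ρ (New.step n e) , e))
    ... | inj₂ n′ = inj₂ (Old.step n′ e)

    unjoined-near : ∀ {w} → ¬ (v New.⇝ w) → New.Near ρ w → Old.Near ρ w
    unjoined-near ¬l n with joined-or-near ≤-refl n
    ... | inj₁ l = contradiction l ¬l
    ... | inj₂ n′ = n′

    unjoined-⇝ : ∀ {u w} → ¬ (v New.⇝ w) → u New.⇝ w → u ⇝ w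
    unjoined-⇝ ¬l ε = ε
    unjoined-⇝ ¬l (x@(nu , nx , e) ◅ xs) =
      (unjoined-near (λ l → ¬l (l ◅◅ x ◅ xs)) nu , unjoined-near (λ l → ¬l (l ◅◅ xs)) nx , e)
      ◅ unjoined-⇝ ¬l xs

    radius-grows : ∀ w → Old.radius w ≤ New.radius w
    radius-grows w = *-monoʳ-≤ A (⌊log₂⌋-mono-≤ (≤-trans
      (count-mono (_⇝? w) (New._⇝? w) P ⇝-weaken) (count-tail-≤ (New._⇝? w) v P)))

    radius-room : ∀ w → Old.radius w + A < ρ
    radius-room w = room _ (m≤n⇒m≤1+n (Old.size-≤ w))

    new-radius-≤ρ : ∀ w → New.radius w ≤ ρ
    new-radius-≤ρ w = <⇒≤ (≤-<-trans (m≤m+n _ _) (room _ (New.size-≤ w)))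

    -- Distance to P, truncated at ρ + 1.
    d : Fin N → ℕ
    d w = least (λ t → Old.near? E? t w) (suc ρ)

    near⇒d≤ : ∀ {t w} → Old.Near t w → d w ≤ t
    near⇒d≤ {w = w} = least-≤ (λ t → Old.near? E? t w) (suc ρ)

    d≤⇒near : ∀ {t w} → t ≤ ρ → d w ≤ t → Old.Near t w
    d≤⇒near {w = w} t≤ρ d≤t = Old.near-mono d≤t
      (least-holds (λ t → Old.near? E? t w) (suc ρ) (s≤s (≤-trans d≤t t≤ρ)))

    outer⇒far : ∀ {t w} → t ≤ ρ → ¬ Old.Near t w → t < d w
    outer⇒far t≤ρ ¬n = ≰⇒> (¬n ∘ d≤⇒near t≤ρ)

    far⇒outer : ∀ {t w} → t < d w → ¬ Old.Near t w
    far⇒outer t<d n = <⇒≱ t<d (near⇒d≤ n)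

    d-adjacent : ∀ {u w} → E u w → d w ≤ suc (d u)
    d-adjacent {u} {w} e with d u ≤? ρ
    ... | yes du≤ρ = near⇒d≤ (Old.step (d≤⇒near du≤ρ ≤-refl) e)
    ... | no du≰ρ  = m≤n⇒m≤1+n (≤-trans (least-≤-bound (λ t → Old.near? E? t w) (suc ρ)) (≰⇒> du≰ρ))

    -- Palettes and transition schedules of the old groups

    Palette : Set
    Palette = ∃[ π ] Compatible {k} {suc k} π π

    localPalette : ∀ w → Dec (Old.Near ρ w) → Palette
    localPalette w (yes n) = let π , inj , _ = proj₂ valid w n in π , inj
    -- Some injective palette is needed even here: if nothing in the new group of `v` was explored
    -- before, this default becomes `π*`.
    localPalette w (no _)  = inject₁ , λ a≢b → a≢b ∘ inject₁-injective

    -- Reading the palette at a canonical node makes it constant on each group.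
    palette : Fin N → Palette
    palette w = let w₀ = Old.canonical E-sym w in localPalette w₀ (Old.near? E? ρ w₀)

    palette-cong : ∀ {u w} → u ⇝ w → palette u ≡ palette w
    palette-cong l = cong (λ w₀ → localPalette w₀ (Old.near? E? ρ w₀)) (Old.canonical-cong E-sym l)

    palette-outer : ∀ {w} → Old.Near ρ w → Old.Outer w → f w ≡ proj₁ (palette w) (c w)
    palette-outer {w} n out with Old.near? E? ρ (Old.canonical E-sym w)
    ... | yes n₀ = proj₂ (proj₂ (proj₂ valid _ n₀)) w (⇝-sym (Old.canonical-⇝ E-sym w)) out
    ... | no ¬n₀ = contradiction (Old.⇝-near (Old.canonical-⇝ E-sym w) n) ¬n₀

    largest : ∃[ w ] (v New.⇝ w × (∀ u → v New.⇝ u → Old.size u ≤ Old.size w))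
    largest = ∃-maximal (v New.⇝?_) Old.size (v , ε)

    w* : Fin N
    w* = proj₁ largest

    π* : Fin k → Fin (suc k)
    π* = proj₁ (palette w*)

    π*-inj : Compatible π* π*
    π*-inj = proj₂ (palette w*)

    -- The group of `w*` keeps `π*` at every stage: its size need not double, so no layers are
    -- available to it.
    stages : (w : Fin N) → Dec (w ⇝ w*) → Palette → ℕ → Fin k → Fin (suc k)
    stages w (yes _) _         _ = π*
    stages w (no _)  (π , inj) i = stage (proj₁ (proj₂ (recoloring π π* inj π*-inj))) i

    schedule : Fin N → ℕ → Fin k → Fin (suc k)
    schedule w = stages w (w ⇝? w*) (palette w)

    schedule-cong : ∀ {u w} → u ⇝ w → schedule u ≡ schedule w
    schedule-cong {u} {w} l rewrite palette-cong l with u ⇝? w* | w ⇝? w*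
    ... | yes _  | yes _  = refl
    ... | no _   | no _   = refl
    ... | yes l′ | no ¬l′ = contradiction (⇝-sym l ◅◅ l′) ¬l′
    ... | no ¬l′ | yes l′ = contradiction (l ◅◅ l′) ¬l′

    schedule-start : ∀ w → schedule w 0 ≡ proj₁ (palette w)
    schedule-start w with w ⇝? w*
    ... | yes l = cong proj₁ (sym (palette-cong l))
    ... | no _  = refl

    schedule-largest : ∀ {w} → w ⇝ w* → ∀ i → schedule w i ≡ π*
    schedule-largest {w} l i with w ⇝? w*
    ... | yes _ = refl
    ... | no ¬l = contradiction l ¬l

    schedule-end : ∀ w {i} → A ≤ i → schedule w i ≗ π*
    schedule-end w {i} A≤i a with w ⇝? w*
    ... | yes _ = refl
    ... | no _  with recoloring (proj₁ (palette w)) π* (proj₂ (palette w)) π*-inj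
    ...   | π′ , ts , _ , π′≗π* = trans (cong (λ π → π a) (stage-final ts A≤i)) (π′≗π* a)

    schedule-injective : ∀ w i → Compatible (schedule w i) (schedule w i)
    schedule-injective w i with w ⇝? w*
    ... | yes _ = π*-inj
    ... | no _  with recoloring (proj₁ (palette w)) π* (proj₂ (palette w)) π*-inj
    ...   | π′ , ts , inj , _ = stage-injective ts inj i

    schedule-compatible : ∀ w i → Compatible (schedule w i) (schedule w (suc i))
    schedule-compatible w i with w ⇝? w*
    ... | yes _ = π*-inj
    ... | no _  with recoloring (proj₁ (palette w)) π* (proj₂ (palette w)) π*-inj
    ...   | π′ , ts , inj , _ = stage-compatible ts inj i

    -- The old exceptional ball keeps `f`, and the layer at distance `radius + 1 + i` follows stage
    -- `i`. Nodes not explored before are covered too, as they lie beyond the last transition layer.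
    layered : Fin N → Fin (suc k)
    layered w with d w ≤? Old.radius w
    ... | yes _ = f w
    ... | no _  = schedule w (d w ∸ suc (Old.radius w)) (c w)

    layered-inner : ∀ {w} → d w ≤ Old.radius w → layered w ≡ f w
    layered-inner {w} inner with d w ≤? Old.radius w
    ... | yes _    = refl
    ... | no outer = contradiction inner outer

    layered-outer : ∀ {w} → Old.radius w < d w → layered w ≡ schedule w (d w ∸ suc (Old.radius w)) (c w)
    layered-outer {w} outer with d w ≤? Old.radius w
    ... | yes inner = contradiction outer (≤⇒≯ inner)
    ... | no _      = refl

    layered-end : ∀ {w} → Old.radius w + A < d w → layered w ≡ π* (c w)
    layered-end {w} far = trans (layered-outer (≤-<-trans (m≤m+n _ _) far))
      (schedule-end w (m+n≤o⇒n≤o∸m (suc (Old.radius w)) far) (c w))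
      where
      m+n≤o⇒n≤o∸m : ∀ m {n o} → m + n ≤ o → n ≤ o ∸ m
      m+n≤o⇒n≤o∸m m {n} le = ≤-trans (≤-reflexive (sym (m+n∸m≡n m n))) (∸-monoˡ-≤ m le)

    layered-far : ∀ {w} → ρ ≤ d w → layered w ≡ π* (c w)
    layered-far {w} far = layered-end (<-≤-trans (radius-room w) far)

    -- Stage 0 is the old palette, which `f` already follows just outside the ball; so `f` and
    -- `layered` coincide on the ball and its first layer.
    layered-boundary : ∀ {w} → Old.Near ρ w → d w ≡ suc (Old.radius w) → layered w ≡ f w
    layered-boundary {w} n d≡ = begin
      layered w                                    ≡⟨ layered-outer outer ⟩
      schedule w (d w ∸ suc (Old.radius w)) (c w)    ≡⟨ cong (λ i → schedule w i (c w)) (m≤n⇒m∸n≡0 (≤-reflexive d≡)) ⟩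
      schedule w 0 (c w)                           ≡⟨ cong (λ π → π (c w)) (schedule-start w) ⟩
      proj₁ (palette w) (c w)                      ≡⟨ palette-outer n (far⇒outer outer) ⟨
      f w                                          ∎
      where
      open ≡-Reasoning
      outer : Old.radius w < d w
      outer = ≤-reflexive (sym d≡)

    -- An edge that meets the ball has both ends in the ball or its first layer, where `f` is
    -- proper. Any other edge lies inside one layer or joins consecutive ones, and the schedule is
    -- injective or compatible there.
    layered-proper-≤ : ∀ {u w} → Old.Near ρ u → Old.Near ρ w → E u w → d u ≤ d w → layered u ≢ layered w
    layered-proper-≤ {u} {w} nu nw e du≤dw eq = go (d w ≤? Old.radius w) (d u ≤? Old.radius u)
      where
      open ≡-Reasoning
      l : u ⇝ w
      l = return (nu , nw , e)
      r≡ : Old.radius u ≡ Old.radius w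
      r≡ = Old.⇝-radius E-sym l
      outer : Old.radius u < d u → d u < d w ⊎ d u ≡ d w →
        schedule w (d u ∸ suc (Old.radius w)) (c u) ≢ schedule w (d w ∸ suc (Old.radius w)) (c w)
      outer _ (inj₂ du≡dw) rewrite du≡dw = schedule-injective w _ (c-proper e)
      outer ru<du (inj₁ du<dw) rewrite ≤-antisym (d-adjacent e) du<dw
                                     | +-∸-assoc 1 {d u} {suc (Old.radius w)} (subst (_< d u) r≡ ru<du) =
        schedule-compatible w _ (c-proper e)
      go : Dec (d w ≤ Old.radius w) → Dec (d u ≤ Old.radius u) → ⊥
      go (yes iw) _ = proj₁ valid u w nu nw e (trans (sym (layered-inner
        (≤-trans du≤dw (≤-trans iw (≤-reflexive (sym r≡)))))) (trans eq (layered-inner iw)))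
      go (no ¬iw) (yes iu) = proj₁ valid u w nu nw e (trans (sym (layered-inner iu))
        (trans eq (layered-boundary nw (≤-antisym
          (≤-trans (d-adjacent e) (s≤s (≤-trans iu (≤-reflexive r≡)))) (≰⇒> ¬iw)))))
      go (no ¬iw) (no ¬iu) = outer (≰⇒> ¬iu) (m≤n⇒m<n∨m≡n du≤dw) (begin
        schedule w (d u ∸ suc (Old.radius w)) (c u) ≡⟨ cong₂ (λ s r → s (d u ∸ suc r) (c u)) (schedule-cong l) r≡ ⟨
        schedule u (d u ∸ suc (Old.radius u)) (c u) ≡⟨ layered-outer (≰⇒> ¬iu) ⟨
        layered u                                 ≡⟨ eq ⟩
        layered w                                 ≡⟨ layered-outer (≰⇒> ¬iw) ⟩
        schedule w (d w ∸ suc (Old.radius w)) (c w) ∎)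

    -- If one end is farther than `ρ` from `P`, the other is at distance at least `ρ`, so both are
    -- colored by `π*` after `c`.
    layered-proper : ∀ {u w} → E u w → layered u ≢ layered w
    layered-proper {u} {w} e eq with d u ≤? ρ | d w ≤? ρ
    ... | no u-far | _ = π*-inj (c-proper e) (trans (sym (layered-far (<⇒≤ (≰⇒> u-far))))
          (trans eq (layered-far (s≤s⁻¹ (≤-trans (≰⇒> u-far) (d-adjacent (E-sym e)))))))
    ... | yes _ | no w-far = π*-inj (c-proper e) (trans (sym (layered-far
          (s≤s⁻¹ (≤-trans (≰⇒> w-far) (d-adjacent e))))) (trans eq (layered-far (<⇒≤ (≰⇒> w-far)))))
    ... | yes du | yes dw with ≤-total (d u) (d w)
    ...   | inj₁ le = layered-proper-≤ (d≤⇒near ≤-refl du) (d≤⇒near ≤-refl dw) e le eq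
    ...   | inj₂ le = layered-proper-≤ (d≤⇒near ≤-refl dw) (d≤⇒near ≤-refl du) (E-sym e) le (sym eq)

    -- The old groups of `u` and `w*` are disjoint, the latter is at least as large, and both enter
    -- the same new group. The size thus doubles, the logarithm gains one, and the radius gains `A`.
    radius-jumps : ∀ {u} → v New.⇝ u → Old.Near ρ u → ¬ (u ⇝ w*) → Old.radius u + A ≤ New.radius u
    radius-jumps {u} l n ¬big = begin
      A * ⌊log₂ s ⌋ + A           ≡⟨ +-comm _ A ⟩
      A + A * ⌊log₂ s ⌋           ≡⟨ *-suc A _ ⟨
      A * suc ⌊log₂ s ⌋           ≡⟨ cong (A *_) (⌊log₂[2*b]⌋≡1+⌊log₂b⌋ s {{>-nonZero s>0}}) ⟨
      A * ⌊log₂ 2 * s ⌋           ≤⟨ *-monoʳ-≤ A (⌊log₂⌋-mono-≤ doubled) ⟩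
      A * ⌊log₂ New.size u ⌋        ∎
      where
      open ≤-Reasoning
      s = Old.size u
      s>0 : 0 < s
      s>0 = let p , p∈P , l = Old.near⇒linked ≤-refl n in count-positive (_⇝? u) p∈P l
      doubled : 2 * s ≤ New.size u
      doubled = begin
        2 * s                  ≡⟨ cong (s +_) (+-identityʳ s) ⟩
        s + s                  ≤⟨ +-monoʳ-≤ s (proj₂ (proj₂ largest) u l) ⟩
        s + Old.size w*          ≤⟨ count-disjoint (_⇝? u) (_⇝? w*) (New._⇝? u) P ⇝-weaken
                                    (λ l* → ⇝-weaken l* ◅◅ New.⇝-sym E-sym (proj₁ (proj₂ largest)) ◅◅ l)
                                    (λ lu l* → ¬big (⇝-sym lu ◅◅ l*)) ⟩
        count (New._⇝? u) P      ≤⟨ count-tail-≤ (New._⇝? u) v P ⟩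
        New.size u               ∎

    -- The coloring after the merge

    extended : Fin N → Fin (suc k)
    extended w with v New.⇝? w
    ... | yes _ = layered w
    ... | no _  = f w

    extended-joined : ∀ {w} → v New.⇝ w → extended w ≡ layered w
    extended-joined {w} l with v New.⇝? w
    ... | yes _ = refl
    ... | no ¬l = contradiction l ¬l

    extended-unjoined : ∀ {w} → ¬ (v New.⇝ w) → extended w ≡ f w
    extended-unjoined {w} ¬l with v New.⇝? w
    ... | yes l = contradiction l ¬l
    ... | no _  = refl

    -- A presented node lies in its exceptional ball whatever the radius, so outputs are never
    -- revised.
    extended-agrees : ∀ {p} → p ∈ P → extended p ≡ f p
    extended-agrees {p} p∈P with v New.⇝? p
    ... | yes _ = layered-inner (near⇒d≤ (Old.base p∈P))
    ... | no _  = refl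

    extended-proper : ∀ u w → New.Near ρ u → New.Near ρ w → E u w → extended u ≢ extended w
    extended-proper u w nu nw e with v New.⇝? u | v New.⇝? w
    ... | yes _ | yes _ = layered-proper e
    ... | no ¬lu | no ¬lw = proj₁ valid u w (unjoined-near ¬lu nu) (unjoined-near ¬lw nw) e
    ... | yes lu | no ¬lw = contradiction (lu ◅◅ return (nu , nw , e)) ¬lw
    ... | no ¬lu | yes lw = contradiction (lw ◅◅ return (nw , nu , E-sym e)) ¬lu

    -- Beyond the new radius every transition is complete: the group of `w*` had `π*` from the
    -- start, a smaller group has gained `A` layers, and a fresh node is farther than `ρ` from `P`.
    extended-outer : ∀ {u} → v New.⇝ u → New.Outer u → extended u ≡ π* (c u)
    extended-outer {u} l out = trans (extended-joined l) (go (u ⇝? w*) (Old.near? E? ρ u))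
      where
      far : New.radius u < d u
      far = outer⇒far (new-radius-≤ρ u) (out ∘ near-weaken)
      go : Dec (u ⇝ w*) → Dec (Old.Near ρ u) → layered u ≡ π* (c u)
      go (yes big) _ = trans (layered-outer (≤-<-trans (radius-grows u) far))
        (cong (λ π → π (c u)) (schedule-largest big _))
      go (no ¬big) (yes n) = layered-end (≤-<-trans (radius-jumps l n ¬big) far)
      go (no _)    (no ¬n) = layered-far (<⇒≤ (outer⇒far ≤-refl ¬n))

    extended-palette : ∀ w → New.Near ρ w → ∃ (New.PaletteAt c extended w)
    extended-palette w nw with v New.⇝? w
    ... | yes l = π* , π*-inj , λ u u⇝w → extended-outer (l ◅◅ New.⇝-sym E-sym u⇝w)
    ... | no ¬l with proj₂ valid w (unjoined-near ¬l nw)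
    ...   | π , inj , out = π , inj , λ u u⇝w outer →
      trans (extended-unjoined λ l → ¬l (l ◅◅ u⇝w))
        (out u (unjoined-⇝ ¬l u⇝w) (outer ∘ New.near-mono (radius-grows u) ∘ near-weaken))

  abstract
    extension : ∃[ g ] (New.Valid c g × (∀ {p} → p ∈ P → g p ≡ f p))
    extension = extended , (extended-proper , extended-palette) , extended-agrees

-- Locality

Matrix : ℕ → Set
Matrix N = Vec (Vec Bool N) N

does⇒ : {A : Set} (a? : Dec A) → T (does a?) → A
does⇒ (yes a) _ = a

⇒does : {A : Set} (a? : Dec A) → A → T (does a?)
⇒does (yes _) _ = _
⇒does (no ¬a) a = ¬a a

Edge : Matrix N → Rel (Fin N) 0ℓ
Edge M a b = T (lookup (lookup M a) b)

adjacent? : (M : Matrix N) → B.Decidable (Edge M)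
adjacent? M a b = T? _

matrix : {R : Rel (Fin N) 0ℓ} → B.Decidable R → Matrix N
matrix R? = tabulateᵛ λ a → tabulateᵛ λ b → does (R? a b)

module _ {R : Rel (Fin N) 0ℓ} (R? : B.Decidable R) where

  lookup-matrix : ∀ a b → lookup (lookup (matrix R?) a) b ≡ does (R? a b)
  lookup-matrix a b = trans (cong (λ row → lookup row b) (lookup∘tabulateᵛ _ a)) (lookup∘tabulateᵛ _ b)

  edge⇒ : Edge (matrix R?) ⇒ R
  edge⇒ {a} {b} e = does⇒ (R? a b) (subst T (lookup-matrix a b) e)

  ⇒edge : R ⇒ Edge (matrix R?)
  ⇒edge {a} {b} r = subst T (sym (lookup-matrix a b)) (⇒does (R? a b) r)

matrix-cong : {R S : Rel (Fin N) 0ℓ} (R? : B.Decidable R) (S? : B.Decidable S) →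
  R ⇒ S → S ⇒ R → matrix R? ≡ matrix S?
matrix-cong R? S? f g = tabulate-cong λ a → tabulate-cong λ b → does-⇔ (mk⇔ f g) (R? a b) (S? a b)

open Ball using (Near; base; step; near-mono; near?)

Inside : ℕ → Rel (Fin N) 0ℓ → List (Fin N) → Rel (Fin N) 0ℓ
Inside t E P a b = Near E P t a × Near E P t b × E a b

near-⊆ : ∀ {E E′ : Rel (Fin N) 0ℓ} {P Q t} → P ⊆ Q → E ⇒ E′ → Near E P t ⊑ Near E′ Q t
near-⊆ P⊆Q E⇒E′ (base w∈P) = base (P⊆Q w∈P)
near-⊆ P⊆Q E⇒E′ (step n e) = step (near-⊆ P⊆Q E⇒E′ n) (E⇒E′ e)

-- Walks of length at most `t` from `P` use only edges with both ends within `t`, so restricting the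
-- graph preserves these distances.
near-inside : ∀ {E E′ : Rel (Fin N) 0ℓ} {P t} → Inside t E P ⇒ E′ → ∀ {s} → s ≤ t →
  Near E P s ⊑ Near E′ P s
near-inside inside _ (base w∈P) = base w∈P
near-inside inside s<t (step n e) = step (near-inside inside (<⇒≤ s<t) n)
  (inside (near-mono _ _ (<⇒≤ s<t) n , near-mono _ _ s<t (step n e) , e))

inside? : ∀ t (M : Matrix N) P → B.Decidable (Inside t (Edge M) P)
inside? t M P a b =
  near? (Edge M) P (adjacent? M) t a ×-dec near? (Edge M) P (adjacent? M) t b ×-dec adjacent? M a b

restrict : ℕ → Matrix N → List (Fin N) → Matrix N
restrict t M P = matrix (inside? t M P)

restrict⇒inside : ∀ t (M : Matrix N) P → Edge (restrict t M P) ⇒ Inside t (Edge M) P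
restrict⇒inside t M P = edge⇒ (inside? t M P)

inside⇒restrict : ∀ t (M : Matrix N) P → Inside t (Edge M) P ⇒ Edge (restrict t M P)
inside⇒restrict t M P = ⇒edge (inside? t M P)

-- An earlier view can be recovered from a later one; this makes it possible to replay past rounds.
restrict-restrict : ∀ t (M : Matrix N) {P Q} → P ⊆ Q → restrict t (restrict t M Q) P ≡ restrict t M P
restrict-restrict t M {P} {Q} P⊆Q = matrix-cong (inside? t (restrict t M Q) P) (inside? t M P)
  (λ (na , nb , e) → weaken na , weaken nb , proj₂ (proj₂ (restrict⇒inside t M Q e)))
  (λ (na , nb , e) → strengthen na , strengthen nb , inside (na , nb , e))
  where
  weaken : Near (Edge (restrict t M Q)) P t ⊑ Near (Edge M) P t
  weaken = near-⊆ id (λ e → proj₂ (proj₂ (restrict⇒inside t M Q e)))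
  inside : Inside t (Edge M) P ⇒ Edge (restrict t M Q)
  inside (na , nb , e) = inside⇒restrict t M Q (near-⊆ P⊆Q id na , near-⊆ P⊆Q id nb , e)
  strengthen : Near (Edge M) P t ⊑ Near (Edge (restrict t M Q)) P t
  strengthen = near-inside inside ≤-refl

module Transfer {k ρ : ℕ} {E E′ : Rel (Fin N) 0ℓ} (E? : B.Decidable E) (E′? : B.Decidable E′)
  (P : List (Fin N))
  (near⇒ : ∀ {s} → s ≤ ρ → Near E P s ⊑ Near E′ P s)
  (near⇐ : ∀ {s} → s ≤ ρ → Near E′ P s ⊑ Near E P s)
  (link⇒ : Inside ρ E P ⇒ E′) (link⇐ : Inside ρ E′ P ⇒ E) where

  private
    module X = Groups E? k ρ P
    module Y = Groups E′? k ρ P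

    ⇝⇒ : X._⇝_ ⇒ Y._⇝_
    ⇝⇒ = Star.map λ (nu , nw , e) → near⇒ ≤-refl nu , near⇒ ≤-refl nw , link⇒ (nu , nw , e)

    ⇝⇐ : Y._⇝_ ⇒ X._⇝_
    ⇝⇐ = Star.map λ (nu , nw , e) → near⇐ ≤-refl nu , near⇐ ≤-refl nw , link⇐ (nu , nw , e)

    radius≡ : ∀ w → X.radius w ≡ Y.radius w
    radius≡ w = cong (λ s → recoloringTime k * ⌊log₂ s ⌋) (≤-antisym
      (count-mono (X._⇝? w) (Y._⇝? w) P ⇝⇒) (count-mono (Y._⇝? w) (X._⇝? w) P ⇝⇐))

  -- Validity depends on the graph only within distance `ρ`, and on the reference coloring only
  -- group by group. An injective relabelling `φ` of a group is absorbed by its palette, which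
  -- becomes `π ∘ φ`.
  transfer : (∀ w → X.radius w ≤ ρ) → ∀ {c c′ f} →
    (∀ w → X.Near ρ w → Σ[ φ ∈ (Fin k → Fin k) ]
      (∀ {a b} → a ≢ b → φ a ≢ φ b) × (∀ u → u X.⇝ w → c u ≡ φ (c′ u))) →
    X.Valid c f → Y.Valid c′ f
  transfer radius≤ρ {f = f} unique (proper , palettes) =
    (λ u w nu nw e → proper u w (near⇐ ≤-refl nu) (near⇐ ≤-refl nw) (link⇐ (nu , nw , e))) ,
    λ w nw → let nw′ = near⇐ ≤-refl nw
                 φ , φ-inj , c≡φc′ = unique w nw′
                 π , π-inj , out = palettes w nw′
             in π ∘ φ , (λ a≢b → π-inj (φ-inj a≢b)) , λ u l outer →
                trans (out u (⇝⇐ l) (λ n → outer (subst (λ r → Y.Near r u) (radius≡ u)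
                  (near⇒ (radius≤ρ u) n)))) (cong π (c≡φc′ u (⇝⇐ l)))

-- The strategy on identifiers

module Strategy {N : ℕ} (k ρ t : ℕ) where

  History : Set
  History = List (Fin N × Fin (suc k))

  Agrees : History → Pred (Fin N → Fin (suc k)) 0ℓ
  Agrees h f = All (λ (v , x) → f v ≡ x) h

  -- The invariant as it can be tested on a view: `g` stands in for the unknown coloring of the
  -- whole graph.
  Extendable : Matrix N → List (Fin N) → Pred History 0ℓ
  Extendable M P h = Σ[ g ∈ (Fin N → Fin k) ]
    (∀ a b → Edge M a b → g a ≢ g b) × ∃[ f ] (Agrees h f × Groups.Valid (adjacent? M) k ρ P g f)

  extendable? : ∀ M P → Decidable (Extendable M P)
  extendable? M P h = anyFunction?
    (λ g≗g′ (proper , f , agrees , valid) →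
      (λ a b e eq → proper a b e (trans (g≗g′ a) (trans eq (sym (g≗g′ b))))) ,
      f , agrees , Groups.valid-cong (adjacent? M) k ρ P g≗g′ (λ _ → refl) valid)
    λ g → (all? λ a → all? λ b → adjacent? M a b →-dec ¬? (g a ≟ g b)) ×-dec
      anyFunction?
        (λ f≗f′ (agrees , valid) → All.map (λ {(v , _)} → trans (sym (f≗f′ v))) agrees ,
          Groups.valid-cong (adjacent? M) k ρ P (λ _ → refl) f≗f′ valid)
        λ f → All.all? (λ (v , x) → f v ≟ x) h ×-dec Groups.valid? (adjacent? M) k ρ P g f

  abstract
    choose : Matrix N → List (Fin N) → Fin N → History → Fin (suc k)
    choose M P v h with any? (λ x → extendable? M P ((v , x) ∷ h))
    ... | yes (x , _) = x
    ... | no _        = zero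

    choose-extendable : ∀ M P v h {x} → Extendable M P ((v , x) ∷ h) →
      Extendable M P ((v , choose M P v h) ∷ h)
    choose-extendable M P v h {x} ext with any? (λ x → extendable? M P ((v , x) ∷ h))
    ... | yes (_ , ext′) = ext′
    ... | no none        = contradiction (x , ext) none

  -- The node list is in reverse order of presentation.
  run : Matrix N → List (Fin N) → History
  run M []       = []
  run M (v ∷ vs) = (v , choose (restrict t M (v ∷ vs)) (v ∷ vs) v (run M vs)) ∷ run M vs

  -- Earlier outputs are not part of a view, so they are recomputed from it; the replay is faithful
  -- because every earlier view is a restriction of the current one.
  run-restrict : ∀ M {Q} vs → vs ⊆ Q → run (restrict t M Q) vs ≡ run M vs
  run-restrict M []       _    = refl
  run-restrict M (v ∷ vs) vs⊆Q = cong₂ (λ M′ h → (v , choose M′ (v ∷ vs) v h) ∷ h)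
    (restrict-restrict t M vs⊆Q) (run-restrict M vs (vs⊆Q ∘ there))

  run-++ : ∀ M us vs → run M vs ⊆ run M (us ++ vs)
  run-++ M []       vs = id
  run-++ M (u ∷ us) vs = there ∘ run-++ M us vs

  run-nodes : ∀ M vs → All (λ (v , _) → v ∈ vs) (run M vs)
  run-nodes M []       = []
  run-nodes M (v ∷ vs) = here refl ∷ All.map there (run-nodes M vs)

  module Correctness (ρ≤t : ρ ≤ t) (M : Matrix N) (M-sym : B.Symmetric (Edge M))
    {c : Fin N → Fin k} (c-proper : ∀ {a b} → Edge M a b → c a ≢ c b)
    (n : ℕ) (room : ∀ m → m ≤ n → recoloringTime k * ⌊log₂ m ⌋ + recoloringTime k < ρ)
    (Real : Pred (Fin N) 0ℓ)
    (unique : ∀ {P} → All Real P → {g : Fin N → Fin k} →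
      (∀ a b → Edge (restrict t M P) a b → g a ≢ g b) → ∀ w → Near (Edge M) P ρ w →
      Σ[ φ ∈ (Fin k → Fin k) ] (∀ {a b} → a ≢ b → φ a ≢ φ b) ×
        (∀ u → Groups._⇝_ (adjacent? M) k ρ P u w → g u ≡ φ (c u)))
    where

    private
      module Restricted (P : List (Fin N)) (bound : length P ≤ n) where
        M′ = restrict t M P

        M′⇒M : Edge M′ ⇒ Edge M
        M′⇒M e = proj₂ (proj₂ (restrict⇒inside t M P e))

        near⇒ : ∀ {s} → s ≤ ρ → Near (Edge M) P s ⊑ Near (Edge M′) P s
        near⇒ s≤ρ = near-inside (inside⇒restrict t M P) (≤-trans s≤ρ ρ≤t)

        near⇐ : ∀ {s} → s ≤ ρ → Near (Edge M′) P s ⊑ Near (Edge M) P s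
        near⇐ _ = near-⊆ id M′⇒M

        link⇒ : Inside ρ (Edge M) P ⇒ Edge M′
        link⇒ (na , nb , e) = inside⇒restrict t M P (near-mono _ _ ρ≤t na , near-mono _ _ ρ≤t nb , e)

        link⇐ : Inside ρ (Edge M′) P ⇒ Edge M
        link⇐ (_ , _ , e) = M′⇒M e

        module Full = Groups (adjacent? M) k ρ P
        module Part = Groups (adjacent? M′) k ρ P

        radius≤ρ : ∀ {s} → s ≤ length P → recoloringTime k * ⌊log₂ s ⌋ ≤ ρ
        radius≤ρ s≤ = <⇒≤ (≤-<-trans (m≤m+n _ _) (room _ (≤-trans s≤ bound)))

        shrink : ∀ {f} → Full.Valid c f → Part.Valid c f
        shrink = Transfer.transfer (adjacent? M) (adjacent? M′) P near⇒ near⇐ link⇒ link⇐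
          (λ w → radius≤ρ (Full.size-≤ w)) λ _ _ → id , id , λ _ _ → refl

        -- The search may succeed with any coloring `g` of the view. Local uniqueness turns its
        -- validity back into validity for the fixed `c`, so the induction over rounds keeps a
        -- single reference coloring.
        restore : All Real P → ∀ {f g} → (∀ a b → Edge M′ a b → g a ≢ g b) → Part.Valid g f → Full.Valid c f
        restore real g-proper = Transfer.transfer (adjacent? M′) (adjacent? M) P near⇐ near⇒ link⇐ link⇒
          (λ w → radius≤ρ (Part.size-≤ w)) λ w nw →
            let φ , inj , g≡φc = unique real g-proper w (near⇐ ≤-refl nw)
            in φ , inj , λ u l → g≡φc u (Star.map (λ (na , nb , e) →
                 near⇐ ≤-refl na , near⇐ ≤-refl nb , M′⇒M e) l)

    Invariant : List (Fin N) → Set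
    Invariant vs = ∃[ f ] (Agrees (run M vs) f × Groups.Valid (adjacent? M) k ρ vs c f)

    -- `c` is proper on the view as well, so the merged coloring `f₁` certifies its own value at `v`
    -- as an admissible answer.
    some-color : ∀ v vs → length (v ∷ vs) ≤ n → Invariant vs →
      ∃[ x ] Extendable (restrict t M (v ∷ vs)) (v ∷ vs) ((v , x) ∷ run M vs)
    some-color v vs len (f , agrees , valid)
      with Extension.extension (adjacent? M) M-sym c-proper v vs (λ m m≤ → room m (≤-trans m≤ len)) valid
    ... | f₁ , valid₁ , f₁≡f = f₁ v , c , (λ a b e → c-proper (M′⇒M e)) , f₁ ,
      refl ∷ All.zipWith (λ (v∈vs , e) → trans (f₁≡f v∈vs) e) (run-nodes M vs , agrees) ,
      shrink valid₁
      where open Restricted (v ∷ vs) len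

    conclude : ∀ v vs → length (v ∷ vs) ≤ n → All Real (v ∷ vs) →
      Extendable (restrict t M (v ∷ vs)) (v ∷ vs) (run M (v ∷ vs)) → Invariant (v ∷ vs)
    conclude v vs len real (g , g-proper , f , agrees , valid) =
      f , agrees , Restricted.restore (v ∷ vs) len real g-proper valid

    invariant : ∀ vs → length vs ≤ n → All Real vs → Invariant vs
    invariant [] _ _ = (λ _ → zero) , [] ,
      (λ u w nu _ _ _ → nowhere nu) , λ w nw → contradiction nw nowhere
      where
      nowhere : ∀ {s w} → ¬ Near (Edge M) [] s w
      nowhere (step n _) = nowhere n
    invariant (v ∷ vs) len real = conclude v vs len real
      (choose-extendable (restrict t M (v ∷ vs)) (v ∷ vs) v (run M vs)
        (proj₂ (some-color v vs len (invariant vs (<⇒≤ len) (All.tail real)))))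

-- Nodes and identifiers

module Identified {n N : ℕ} (G : Graph n) (ident : Fin n → Fin N) (inj : Injective _≡_ _≡_ ident) where
  open Graph G

  _~̂_ : Rel (Fin N) 0ℓ
  a ~̂ b = ∃[ u ] ∃[ v ] (ident u ≡ a × ident v ≡ b × u ~ v)

  _~̂?_ : B.Decidable _~̂_
  a ~̂? b = any? λ u → any? λ v → (ident u ≟ a) ×-dec (ident v ≟ b) ×-dec T? (adj u v)

  Ĝ : Matrix N
  Ĝ = matrix _~̂?_

  _–_ : Rel (Fin N) 0ℓ
  _–_ = Edge Ĝ

  edge⁺ : ∀ {u v} → u ~ v → ident u – ident v
  edge⁺ e = ⇒edge _~̂?_ (_ , _ , refl , refl , e)

  edge⁻ : ∀ {u b} → ident u – b → ∃[ v ] (ident v ≡ b × u ~ v)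
  edge⁻ e with edge⇒ _~̂?_ e
  ... | u , v , u≡ , v≡ , e′ = v , v≡ , subst (_~ v) (inj u≡) e′

  –-sym : B.Symmetric _–_
  –-sym e with edge⇒ _~̂?_ e
  ... | u , v , refl , refl , e′ = edge⁺ (~-sym e′)

  Real : Pred (Fin N) 0ℓ
  Real a = ∃[ u ] ident u ≡ a

  real? : Decidable Real
  real? a = any? λ u → ident u ≟ a

  -- Identifiers of no node are isolated, so their color is irrelevant.
  push : ∀ {k} → (Fin n → Fin (suc k)) → Fin N → Fin (suc k)
  push c a with real? a
  ... | yes (u , _) = c u
  ... | no _        = zero

  push-ident : ∀ {k} (c : Fin n → Fin (suc k)) u → push c (ident u) ≡ c u
  push-ident c u with real? (ident u)
  ... | yes (_ , e) = cong c (inj e)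
  ... | no ¬real    = contradiction (u , refl) ¬real

  push-proper : ∀ {k} {c : Fin n → Fin (suc k)} → Proper G c → ∀ {a b} → a – b → push c a ≢ push c b
  push-proper {c = c} proper e with edge⇒ _~̂?_ e
  ... | u , v , refl , refl , e′ = λ eq →
    proper e′ (trans (sym (push-ident c u)) (trans eq (push-ident c v)))

  near-walk : ∀ {P s u v m} → Near _–_ P s (ident u) → Walk _~_ u v m → Near _–_ P (s + m) (ident v)
  near-walk {P} {s} {u} near nil = subst (λ r → Near _–_ P r (ident u)) (sym (+-identityʳ s)) near
  near-walk {P} {s} {v = v} near (cons {m = m} e walk) =
    subst (λ r → Near _–_ P r (ident v)) (sym (+-suc s m)) (near-walk (step near (edge⁺ e)) walk)

  -- Used with `s` zero for the views, and with `s` equal to `ρ` for the surroundings of a group at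
  -- distance `ℓ`.
  near-ball : ∀ {U P s t} → (∀ {u} → U u → Near _–_ P s (ident u)) → ∀ {v} → 𝓑 G U t v →
    Near _–_ P (s + t) (ident v)
  near-ball {P = P} {s} near (u , Uu , m , m≤t , walk) =
    near-mono _–_ P (+-monoʳ-≤ s (s≤s⁻¹ m≤t)) (near-walk (near Uu) walk)

  walk-snoc : ∀ {u v w m} → Walk _~_ u v m → v ~ w → Walk _~_ u w (suc m)
  walk-snoc nil           e = cons e nil
  walk-snoc (cons e′ walk) e = cons e′ (walk-snoc walk e)

  ball-near : ∀ {U P t a} → (∀ {p} → p ∈ P → ∃[ u ] (ident u ≡ p × U u)) → Near _–_ P t a →
    ∃[ v ] (ident v ≡ a × 𝓑 G U t v)
  ball-near source (base p∈P) = let u , u≡ , Uu = source p∈P in u , u≡ , u , Uu , 0 , z<s , nil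
  ball-near source (step near e) with ball-near source near
  ... | v , refl , u , Uu , m , m<t , walk with edge⁻ e
  ...   | w , w≡ , e′ = w , w≡ , u , Uu , suc m , s<s m<t , walk-snoc walk e′

  near-real : ∀ {P t a} → All Real P → Near _–_ P t a → Real a
  near-real real near with ball-near {U = λ _ → ⊤} (λ p∈P → let u , u≡ = All.lookup real p∈P in u , u≡ , _) near
  ... | v , v≡ , _ = v , v≡

  -- Views of the rounds as restricted matrices

  module Rounds (σ : Permutation′ n) (t : ℕ) where

    arrived : Fin n → List (Fin N)
    arrived i = reverse (map ident (presentedUpTo G ident σ t i))

    view-edges : ∀ i → View.edges (view G ident σ t i) ≡ restrict t Ĝ (arrived i)
    view-edges i = matrix-cong (edge? G ident σ t i) (inside? t Ĝ (arrived i))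
      (λ { (u , v , (refl , su) , (refl , sv) , e) → near su , near sv , edge⁺ e })
      λ (na , nb , e) → let u , u≡ , su = seen na ; v , v≡ , sv = seen nb in
        u , v , (u≡ , su) , (v≡ , sv) , real-edge u≡ v≡ e
      where
      near : ∀ {u} → Seen G ident σ t i u → Near _–_ (arrived i) t (ident u)
      near = near-ball (λ u∈ → base (Any.reverse⁺ (∈-map⁺ ident u∈)))
      seen : ∀ {a} → Near _–_ (arrived i) t a → ∃[ u ] (ident u ≡ a × Seen G ident σ t i u)
      seen = ball-near λ p∈ → let u , u∈ , p≡ = ∈-map⁻ ident (Any.reverse⁻ p∈) in u , sym p≡ , u∈
      real-edge : ∀ {a b u v} → ident u ≡ a → ident v ≡ b → a – b → u ~ v
      real-edge refl v≡ e with edge⁻ e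
      ... | _ , v≡′ , e′ = subst (_ ~_) (inj (trans v≡′ (sym v≡))) e′

    arrived-head : ∀ i → ∃[ vs ] arrived i ≡ ident (σ ⟨$⟩ʳ i) ∷ vs
    arrived-head i = reverse (map ident earlier) , (begin
      reverse (map ident (take (suc (toℕ i)) (tabulate (σ ⟨$⟩ʳ_))))
        ≡⟨ cong (reverse ∘ map ident) (take-suc-tabulate (σ ⟨$⟩ʳ_) i) ⟩
      reverse (map ident (earlier ++ [ σ ⟨$⟩ʳ i ]))
        ≡⟨ cong reverse (map-++ ident earlier _) ⟩
      reverse (map ident earlier ++ [ ident (σ ⟨$⟩ʳ i) ])
        ≡⟨ reverse-++ (map ident earlier) _ ⟩
      ident (σ ⟨$⟩ʳ i) ∷ reverse (map ident earlier) ∎)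
      where
      open ≡-Reasoning
      earlier : List (Fin n)
      earlier = take (toℕ i) (tabulate (σ ⟨$⟩ʳ_))

    everyone : List (Fin N)
    everyone = reverse (map ident (tabulate (σ ⟨$⟩ʳ_)))

    arrived-suffix : ∀ i → ∃[ us ] us ++ arrived i ≡ everyone
    arrived-suffix i = reverse (map ident (drop m xs)) , (begin
      reverse (map ident (drop m xs)) ++ reverse (map ident (take m xs))
        ≡⟨ reverse-++ (map ident (take m xs)) (map ident (drop m xs)) ⟨
      reverse (map ident (take m xs) ++ map ident (drop m xs))
        ≡⟨ cong reverse (map-++ ident (take m xs) (drop m xs)) ⟨
      reverse (map ident (take m xs ++ drop m xs))
        ≡⟨ cong (reverse ∘ map ident) (take++drop≡id m xs) ⟩
      everyone ∎)
      where
      open ≡-Reasoning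
      m = suc (toℕ i)
      xs = tabulate (σ ⟨$⟩ʳ_)

    everyone-length : length everyone ≡ n
    everyone-length = trans (length-reverse (map ident xs)) (trans (length-map ident xs) (length-tabulate _))
      where xs = tabulate (σ ⟨$⟩ʳ_)

    everyone-real : All Real everyone
    everyone-real = All.tabulate λ p∈ → let u , _ , p≡ = ∈-map⁻ ident (Any.reverse⁻ {xs = map ident (tabulate (σ ⟨$⟩ʳ_))} p∈) in u , sym p≡

    everyone-complete : ∀ v → ident v ∈ everyone
    everyone-complete v = Any.reverse⁺ (∈-map⁺ ident
      (subst (_∈ tabulate (σ ⟨$⟩ʳ_)) (inverseʳ σ) (∈-tabulate⁺ (σ ⟨$⟩ˡ v))))

  -- Local uniqueness applied to a group

  module Uniqueness (k ℓ ρ : ℕ) {c : Fin n → Fin (suc k)} (proper : Proper G c) (G∈𝓛 : 𝓛 (suc k) ℓ G)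
    {P : List (Fin N)} (real : All Real P) {g : Fin N → Fin (suc k)}
    (g-proper : ∀ a b → Edge (restrict (ρ + ℓ) Ĝ P) a b → g a ≢ g b)
    (w : Fin N) (near-w : Near _–_ P ρ w) where

    open Groups (adjacent? Ĝ) (suc k) ρ P hiding (Near)

    member : Fin n → Bool
    member u = does (ident u ⇝? w)

    ∈⇒ : ∀ {u} → u Subset.∈ tabulateᵛ member → ident u ⇝ w
    ∈⇒ {u} u∈ = does⇒ (ident u ⇝? w) (subst T
      (trans (sym ([]=⇒lookup u∈)) (lookup∘tabulateᵛ member u)) _)

    ⇒∈ : ∀ {u} → ident u ⇝ w → u Subset.∈ tabulateᵛ member
    ⇒∈ {u} l = lookup⇒[]= u _ (trans (lookup∘tabulateᵛ member u) (dec-true (ident u ⇝? w) l))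

    edge′? : ∀ u v → Dec (u ~ v × ident u ⇝ w × ident v ⇝ w)
    edge′? u v = T? (adj u v) ×-dec (ident u ⇝? w) ×-dec (ident v ⇝? w)

    component : Subgraph G
    component = record
      { V′     = tabulateᵛ member
      ; E′     = λ u v → does (edge′? u v)
      ; ~′-sym = λ {u} {v} e → let e′ , lu , lv = does⇒ (edge′? u v) e in
                   ⇒does (edge′? v u) (~-sym e′ , lv , lu)
      ; ~′⇒~   = λ {u} {v} e → proj₁ (does⇒ (edge′? u v) e)
      ; ~′⇒∈   = λ {u} {v} e → let _ , lu , lv = does⇒ (edge′? u v) e in ⇒∈ lu , ⇒∈ lv
      }

    component-walk : ∀ {u v b} → ident u ⇝ b → b ≡ ident v → b ⇝ w →
      ∃[ m ] Walk (Subgraph._~′_ component) u v m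
    component-walk {u} {v} ε eq _ = 0 , subst (λ v → Walk _ u v 0) (inj eq) nil
    component-walk {u} (x@(_ , _ , e) ◅ xs) eq l with edge⁻ e
    ... | u′ , refl , e′ with component-walk xs eq l
    ...   | m , walk = suc m , cons (⇒does (edge′? u u′) (e′ , x ◅ xs ◅◅ l , xs ◅◅ l)) walk

    component-connected : ConnectedSubgraph G component
    component-connected u∈ v∈ =
      component-walk (∈⇒ u∈ ◅◅ ⇝-sym –-sym (∈⇒ v∈)) refl (∈⇒ v∈)

    member-near : ∀ {u} → u Subset.∈ tabulateᵛ member → Near _–_ P ρ (ident u)
    member-near u∈ = ⇝-near (∈⇒ u∈) near-w

    global∈𝓒 : 𝓒 G (suc k) ℓ component c
    global∈𝓒 = c , (λ _ _ → proper) , λ _ → refl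

    local∈𝓒 : 𝓒 G (suc k) ℓ component (g ∘ ident)
    local∈𝓒 = g ∘ ident , (λ u∈ v∈ e → g-proper _ _
      (inside⇒restrict (ρ + ℓ) Ĝ P (near-ball member-near u∈ , near-ball member-near v∈ , edge⁺ e))) ,
      λ _ → refl

    -- The group of `w` is a connected subgraph within `ρ` of `P`, so its surroundings up to
    -- distance `ℓ` are visible with locality `ρ + ℓ`. Both `c` and `g` are proper there, and
    -- membership in `𝓛` relates them by a permutation.
    unique : Σ[ φ ∈ (Fin (suc k) → Fin (suc k)) ] (∀ {a b} → a ≢ b → φ a ≢ φ b) ×
      (∀ a → a ⇝ w → g a ≡ φ (push c a))
    unique with proj₂ G∈𝓛 component component-connected c (g ∘ ident) global∈𝓒 local∈𝓒
    ... | φ , agree = φ ⟨$⟩ʳ_ ,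
      (λ a≢b eq → a≢b (trans (sym (inverseˡ φ)) (trans (cong (φ ⟨$⟩ˡ_) eq) (inverseˡ φ)))) , λ a l →
      same l (near-real real (⇝-near l near-w))
      where
      same : ∀ {a} → a ⇝ w → Real a → g a ≡ φ ⟨$⟩ʳ push c a
      same l (u , refl) = trans (agree (⇒∈ l)) (cong (φ ⟨$⟩ʳ_) (sym (push-ident c u)))

-- The algorithm, its locality and its correctness

newest : ∀ {A : Set} {k} → List (A × Fin (suc k)) → Fin (suc k)
newest []            = zero
newest ((_ , x) ∷ _) = x

module Algorithm (k ℓ : ℕ) (idBound : ℕ → ℕ) where

  A : ℕ
  A = recoloringTime (suc k)

  -- The value of `ρ`: the largest possible radius, one more transition of `A` layers, and one for
  -- the strict inequality in `room`.
  inner : ℕ → ℕ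
  inner n = suc (A * ⌊log₂ n ⌋ + A)

  play : ∀ n → Matrix (idBound n) → List (Fin (idBound n)) → List (Fin (idBound n) × Fin (suc (suc k)))
  play n = Strategy.run (suc k) (inner n) (inner n + ℓ)

  algorithm : OnlineLocal idBound (suc (suc k))
  algorithm = record
    { locality = λ n → inner n + ℓ
    ; output   = λ n V → newest (play n (View.edges V) (reverse (View.presented V)))
    }

  logarithmic : OnlineLocal.locality algorithm =O ⌊log₂_⌋
  -- From `n` equal to 2 on, the logarithm is at least 1 and absorbs the additive constant
  -- `suc (A + ℓ)`.
  logarithmic = A + suc (A + ℓ) , 2 , λ n 2≤n → begin
    suc (A * ⌊log₂ n ⌋ + A) + ℓ             ≡⟨ cong suc (+-assoc _ A ℓ) ⟩
    suc (A * ⌊log₂ n ⌋ + (A + ℓ))           ≡⟨ +-suc _ (A + ℓ) ⟨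
    A * ⌊log₂ n ⌋ + suc (A + ℓ)             ≡⟨ cong (A * ⌊log₂ n ⌋ +_) (*-identityʳ (suc (A + ℓ))) ⟨
    A * ⌊log₂ n ⌋ + suc (A + ℓ) * 1         ≤⟨ +-monoʳ-≤ (A * ⌊log₂ n ⌋) (*-monoʳ-≤ (suc (A + ℓ)) (⌊log₂⌋-mono-≤ 2≤n)) ⟩
    A * ⌊log₂ n ⌋ + suc (A + ℓ) * ⌊log₂ n ⌋ ≡⟨ *-distribʳ-+ ⌊log₂ n ⌋ A (suc (A + ℓ)) ⟨
    (A + suc (A + ℓ)) * ⌊log₂ n ⌋           ∎
    where open ≤-Reasoning

  module Run {n : ℕ} (G : Graph n) (G∈𝓛 : 𝓛 (suc k) ℓ G) (ident : Fin n → Fin (idBound n))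
    (inj : Injective _≡_ _≡_ ident) (σ : Permutation′ n) where

    open Identified G ident inj
    open Rounds σ (inner n + ℓ)
    open Strategy {N = idBound n} (suc k) (inner n) (inner n + ℓ)

    color : Fin n → Fin (suc (suc k))
    color = OnlineLocal.coloring algorithm G ident σ

    invariant : ∃[ f ] (Agrees (run Ĝ everyone) f ×
      Groups.Valid (adjacent? Ĝ) (suc k) (inner n) everyone (push (proj₁ (proj₁ G∈𝓛))) f)
    invariant = Correctness.invariant (m≤m+n (inner n) ℓ) Ĝ –-sym (push-proper (proj₂ (proj₁ G∈𝓛))) n
      (λ m m≤n → s≤s (+-monoˡ-≤ A (*-monoʳ-≤ A (⌊log₂⌋-mono-≤ m≤n)))) Real
      (λ real → Uniqueness.unique k ℓ (inner n) (proj₂ (proj₁ G∈𝓛)) G∈𝓛 real)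
      everyone (≤-reflexive everyone-length) everyone-real

    newest-recorded : ∀ {i vs} → ∃[ us ] vs ≡ ident (σ ⟨$⟩ʳ i) ∷ us →
      (ident (σ ⟨$⟩ʳ i) , newest (run Ĝ vs)) ∈ run Ĝ vs
    newest-recorded (_ , refl) = here refl

    -- All outputs are entries of one run on the whole graph: replaying on a view agrees with
    -- replaying on `Ĝ`, and later rounds only prepend entries.
    recorded-round : ∀ i → (ident (σ ⟨$⟩ʳ i) , newest (run (View.edges (view G ident σ (inner n + ℓ) i)) (arrived i)))
      ∈ run Ĝ everyone
    recorded-round i rewrite view-edges i | run-restrict Ĝ (arrived i) id
      with us , eq ← arrived-suffix i =
      subst (λ vs → (ident (σ ⟨$⟩ʳ i) , newest (run Ĝ (arrived i))) ∈ run Ĝ vs) eq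
        (run-++ Ĝ us (arrived i) (newest-recorded (arrived-head i)))

    recorded : ∀ v → (ident v , color v) ∈ run Ĝ everyone
    recorded v = subst (λ u → (ident u , color v) ∈ run Ĝ everyone) (inverseʳ σ) (recorded-round (σ ⟨$⟩ˡ v))

    -- At the end every node is presented, so the coloring `f` of the invariant is proper on all
    -- edges and agrees with all outputs.
    color-proper : Proper G color
    color-proper {u} {v} e eq with invariant
    ... | f , agrees , proper , _ = proper (ident u) (ident v)
      (base (everyone-complete u)) (base (everyone-complete v)) (edge⁺ e)
      (trans (All.lookup agrees (recorded u)) (trans eq (sym (All.lookup agrees (recorded v)))))

theorem4 : (k ℓ : ℕ) → 2 ≤ k → (idBound : ℕ → ℕ) → PolynomiallyBounded idBound →
    Σ (OnlineLocal idBound (suc k)) λ A →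
    (OnlineLocal.locality A =O ⌊log₂_⌋) ×
    OnlineLocal.SolvesColoringOn A (λ G → Connected G × 𝓛 k ℓ G)
theorem4 (suc k) ℓ (s≤s _) idBound _ = algorithm , logarithmic ,
  λ G (_ , G∈𝓛) ident inj σ → Run.color-proper G G∈𝓛 ident inj σ
  where open Algorithm k ℓ idBound
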